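{- The logic $\mathsf{KM}$ has the uniform interpolation property: for every formula $\varphi$ and every propositional variable $p$ there exist formulas $\forall p\,\varphi$ and $\exists p\,\varphi$ such that 1. ($p$-freeness) $\mathrm{Vars}(\exists p\,\varphi)\subseteq \mathrm{Vars}(\varphi)\setminus\{p\}$ and $\mathrm{Vars}(\forall p\,\varphi)\subseteq \mathrm{Vars}(\varphi)\setminus\{p\}$; 2. (implication) $\vdash_{\mathsf{KM}}\varphi\to\exists p\,\varphi$ and $\vdash_{\mathsf{KM}}\forall p\,\varphi\to\varphi$; 3. (uniformity) for each formula $\psi$ with $p\notin\mathrm{Vars}(\psi)$: $\vdash_{\mathsf{KM}}\varphi\to\psi$ implies $\vdash_{\mathsf{KM}}\exists p\,\varphi\to\psi$, and $\vdash_{\mathsf{KM}}\psi\to\varphi$ implies $\vdash_{\mathsf{KM}}\psi\to\forall p\,\varphi$.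
   Context: Let $\mathsf{Prop}$ be a countably infinite set of propositional variables with decidable equality. Formulas: $\varphi ::= p\in\mathsf{Prop}\mid\bot\mid\varphi\land\varphi\mid\varphi\lor\varphi\mid\varphi\to\varphi\mid\Box\varphi$. $\mathrm{Vars}(\varphi)$ is the set of propositional variables occurring in $\varphi$. The logic $\mathsf{KM}$ is given by the generalised Hilbert calculus $\mathsf{KMH}$, which derives consecutions $\Gamma\vdash\varphi$ ($\Gamma$ a set of formulas, $\varphi$ a formula). Axioms: all instances of the axiom schemes of a standard Hilbert system for intuitionistic propositional logic, together with all instances of (K) $\Box(\varphi\to\psi)\to(\Box\varphi\to\Box\psi)$; (SL) $(\Box\varphi\to\varphi)\to\varphi$; (KM) $\Box\varphi\to(\psi\lor(\psi\to\varphi))$. Rules: (Ax) $\Gamma\vdash\varphi$ if $\varphi$ is an instance of an axiom; (El) $\Gamma\vdash\varphi$ if $\varphi\in\Gamma$; (MP) from $\Gamma\vdash\varphi$ and $\Gamma\vdash\varphi\to\psi$ infer $\Gamma\vdash\psi$; (Nec) from $\Gamma\vdash\varphi$ infer $\Gamma\vdash\Box\varphi$. Write $\vdash_{\mathsf{KM}}\varphi$ if $\emptyset\vdash\varphi$ is provable in $\mathsf{KMH}$. -}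

module Defs where

open import Level using (0ℓ)
open import Relation.Unary using (Pred; _∈_; ∅; ｛_｝; _∪_)

infixr 6 _⇒_
infixr 7 _∨_
infixr 8 _∧_
infix  9 □_
infix  4 _⊢_ ⊢KM_

data Formula (V : Set) : Set where
  var         : V → Formula V
  ⊥ᶠ          : Formula V
  _∧_ _∨_ _⇒_ : Formula V → Formula V → Formula V
  □_          : Formula V → Formula V

Vars : {V : Set} → Formula V → Pred V 0ℓ
Vars (var q) = ｛ q ｝
Vars ⊥ᶠ      = ∅
Vars (φ ∧ ψ) = Vars φ ∪ Vars ψ
Vars (φ ∨ ψ) = Vars φ ∪ Vars ψ
Vars (φ ⇒ ψ) = Vars φ ∪ Vars ψ
Vars (□ φ)   = Vars φ

data Axiom {V : Set} : Formula V → Set where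
  ⇒-const : ∀ φ ψ → Axiom (φ ⇒ (ψ ⇒ φ))
  ⇒-dist  : ∀ φ ψ χ → Axiom ((φ ⇒ (ψ ⇒ χ)) ⇒ ((φ ⇒ ψ) ⇒ (φ ⇒ χ)))
  ∧-elimˡ : ∀ φ ψ → Axiom ((φ ∧ ψ) ⇒ φ)
  ∧-elimʳ : ∀ φ ψ → Axiom ((φ ∧ ψ) ⇒ ψ)
  ∧-intro : ∀ φ ψ → Axiom (φ ⇒ (ψ ⇒ (φ ∧ ψ)))
  ∨-introˡ : ∀ φ ψ → Axiom (φ ⇒ (φ ∨ ψ))
  ∨-introʳ : ∀ φ ψ → Axiom (ψ ⇒ (φ ∨ ψ))
  ∨-elim  : ∀ φ ψ χ → Axiom ((φ ⇒ χ) ⇒ ((ψ ⇒ χ) ⇒ ((φ ∨ ψ) ⇒ χ)))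
  ⊥-elim  : ∀ φ → Axiom (⊥ᶠ ⇒ φ)
  K       : ∀ φ ψ → Axiom (□ (φ ⇒ ψ) ⇒ (□ φ ⇒ □ ψ))
  SL      : ∀ φ → Axiom ((□ φ ⇒ φ) ⇒ φ)
  KM      : ∀ φ ψ → Axiom (□ φ ⇒ (ψ ∨ (ψ ⇒ φ)))

-- Necessitation keeps its context Γ, so Γ acts as a set of global assumptions.
data _⊢_ {V : Set} (Γ : Pred (Formula V) 0ℓ) : Formula V → Set where
  Ax  : ∀ {φ} → Axiom φ → Γ ⊢ φ
  El  : ∀ {φ} → φ ∈ Γ → Γ ⊢ φ
  MP  : ∀ {φ ψ} → Γ ⊢ φ → Γ ⊢ φ ⇒ ψ → Γ ⊢ ψ
  Nec : ∀ {φ} → Γ ⊢ φ → Γ ⊢ □ φ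

⊢KM_ : {V : Set} → Formula V → Set
⊢KM φ = ∅ ⊢ φ

{-# OPTIONS --safe #-}

-- KM is the logic of finite trees with persistent valuations in which □A holds at a node iff A
-- holds at all its children.  Since A ⇒ B holds at a node iff it holds classically there and at
-- all children, the formulas true at a node are computed classically from its variables and from
-- the finitely many relevant formulas forced by all children; call this data the state.  For a
-- set B of formulas, the states refuting A over B give, by induction on the number of formulas
-- not in B, formulas ∀p(⋀B ⇒ A) and ∃p(⋀B).  That they express "all (resp. some) trees agreeing
-- with this one on p-free formulas" is shown by building such a tree from trees for its children,
-- and the same recursion without a given tree proves completeness.
module Submission where

open import Defs
open import Data.Bool using (Bool; T)
open import Data.Bool.Properties using (T?)
open import Data.Empty using (⊥)
open import Data.Fin using (Fin; _↑ˡ_; _↑ʳ_; splitAt)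
open import Data.Fin.Properties using (all?; ¬∀⟶∃¬; splitAt-↑ˡ; splitAt-↑ʳ)
open import Data.List using (List; []; _∷_; _++_; map; filter; length; lookup; cartesianProduct)
open import Data.List.Membership.Propositional using (_∈_; _∉_; find; lose)
open import Data.List.Membership.Propositional.Properties using
  (∈-map⁺; ∈-map⁻; ∈-++⁺ˡ; ∈-++⁺ʳ; ∈-++⁻; ∈-filter⁺; ∈-filter⁻; ∈-cartesianProduct⁺;
   ∈-cartesianProduct⁻; ∈-lookup)
open import Data.List.Relation.Binary.Subset.Propositional using (_⊆_)
open import Data.List.Relation.Unary.All as All using (All; []; _∷_)
import Data.List.Relation.Unary.All.Properties as All
open import Data.List.Relation.Unary.Any as Any using (Any; here; there)
import Data.List.Relation.Unary.Any.Properties as Any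
open import Data.Nat as ℕ using (ℕ; zero; suc; _≤_; _<_; z≤n; s≤s)
open import Data.Nat.Properties using (≤-refl; ≤-trans; m≤n⇒m≤1+n; ≤-pred)
open import Data.Product using (_×_; _,_; proj₁; proj₂; ∃-syntax; uncurry)
open import Data.Product.Function.NonDependent.Propositional using (_×-⇔_)
open import Data.Sum using (_⊎_; inj₁; inj₂; [_,_]; [_,_]′; map₂; swap)
open import Data.Sum.Function.Propositional using (_⊎-⇔_)
open import Function using (_∘_; id; _⇔_; _↔_; mk⇔; Equivalence)
open import Function.Construct.Identity using (⇔-id)
open import Function.Related.TypeIsomorphisms using (→-cong-⇔)
open import Relation.Binary.Definitions using (DecidableEquality)
open import Relation.Binary.PropositionalEquality using (_≢_; refl; sym; cong; cong₂; subst)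
open import Relation.Nullary using (¬_; Dec; yes; no; contradiction; ¬?)
open import Relation.Nullary.Decidable using
  (_×-dec_; _⊎-dec_; _→-dec_; map′; decidable-stable; toWitness; fromWitness; ⌊_⌋)
import Relation.Unary as Unary

open Equivalence using (to; from)

-- Finite lists: sublists, filtering and search.

private variable
  X : Set

sublists : List X → List (List X)
sublists []       = [] ∷ []
sublists (x ∷ xs) = map (x ∷_) (sublists xs) ++ sublists xs

∈-sublists⇒⊆ : (xs : List X) {ys : List X} → ys ∈ sublists xs → ys ⊆ xs
∈-sublists⇒⊆ []       (here refl) ()
∈-sublists⇒⊆ (x ∷ xs) ys∈ y∈ with ∈-++⁻ (map (x ∷_) (sublists xs)) ys∈
... | inj₂ ys∈xs = there (∈-sublists⇒⊆ xs ys∈xs y∈)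
... | inj₁ x∷ys∈ with ∈-map⁻ (x ∷_) x∷ys∈ | y∈
...   | _ , _   , refl | here refl  = here refl
...   | _ , zs∈ , refl | there y∈zs = there (∈-sublists⇒⊆ xs zs∈ y∈zs)

module _ {P : X → Set} (P? : Unary.Decidable P) where

  filter∈sublists : ∀ xs → filter P? xs ∈ sublists xs
  filter∈sublists []       = here refl
  filter∈sublists (x ∷ xs) with P? x
  ... | yes _ = ∈-++⁺ˡ (∈-map⁺ (x ∷_) (filter∈sublists xs))
  ... | no  _ = ∈-++⁺ʳ _ (filter∈sublists xs)

module _ {P Q : X → Set} (P? : Unary.Decidable P) (Q? : Unary.Decidable Q) (P⊆Q : P Unary.⊆ Q) where

  length-filter-≤ : ∀ xs → length (filter P? xs) ≤ length (filter Q? xs)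
  length-filter-≤ [] = z≤n
  length-filter-≤ (x ∷ xs) with P? x | Q? x
  ... | yes _ | yes _ = s≤s (length-filter-≤ xs)
  ... | yes p | no ¬q = contradiction (P⊆Q p) ¬q
  ... | no  _ | yes _ = m≤n⇒m≤1+n (length-filter-≤ xs)
  ... | no  _ | no  _ = length-filter-≤ xs

  length-filter-< : ∀ {x xs} → x ∈ xs → Q x → ¬ P x → length (filter P? xs) < length (filter Q? xs)
  length-filter-< {xs = y ∷ xs} (here refl) q ¬p with P? y | Q? y
  ... | yes p | _     = contradiction p ¬p
  ... | no  _ | yes _ = s≤s (length-filter-≤ xs)
  ... | no  _ | no ¬q = contradiction q ¬q
  length-filter-< {xs = y ∷ xs} (there x∈) q ¬p with P? y | Q? y
  ... | yes _ | yes _ = s≤s (length-filter-< x∈ q ¬p)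
  ... | yes p | no ¬q = contradiction (P⊆Q p) ¬q
  ... | no  _ | yes _ = m≤n⇒m≤1+n (length-filter-< x∈ q ¬p)
  ... | no  _ | no  _ = length-filter-< x∈ q ¬p

some-or-all : {P Q : X → Set} (xs : List X) → (∀ {x} → x ∈ xs → P x ⊎ Q x) →
  (∃[ x ] x ∈ xs × P x) ⊎ (∀ {x} → x ∈ xs → Q x)
some-or-all []       f = inj₂ λ ()
some-or-all (x ∷ xs) f with f (here refl) | some-or-all xs (f ∘ there)
... | inj₁ p | _                  = inj₁ (x , here refl , p)
... | inj₂ _ | inj₁ (y , y∈ , p)  = inj₁ (y , there y∈ , p)
... | inj₂ q | inj₂ qs            = inj₂ λ where
  (here refl) → q
  (there x∈)  → qs x∈

-- Syntax, and truth at a single node.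

private variable
  V : Set
  A B C : Formula V

-- The formulas A whose forcing at all children matters for a formula: those occurring boxed, and
-- all implications.
boxes : Formula V → List (Formula V)
boxes (var q) = []
boxes ⊥ᶠ      = []
boxes (A ∧ B) = boxes A ++ boxes B
boxes (A ∨ B) = boxes A ++ boxes B
boxes (A ⇒ B) = (A ⇒ B) ∷ boxes A ++ boxes B
boxes (□ A)   = A ∷ boxes A

vars : Formula V → List V
vars (var q) = q ∷ []
vars ⊥ᶠ      = []
vars (A ∧ B) = vars A ++ vars B
vars (A ∨ B) = vars A ++ vars B
vars (A ⇒ B) = vars A ++ vars B
vars (□ A)   = vars A

∈-vars⇒Vars : ∀ (A : Formula V) {q} → q ∈ vars A → Vars A q
∈-vars⇒Vars (var q) (here refl) = refl
∈-vars⇒Vars (A ∧ B) q∈ = [ inj₁ ∘ ∈-vars⇒Vars A , inj₂ ∘ ∈-vars⇒Vars B ]′ (∈-++⁻ (vars A) q∈)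
∈-vars⇒Vars (A ∨ B) q∈ = [ inj₁ ∘ ∈-vars⇒Vars A , inj₂ ∘ ∈-vars⇒Vars B ]′ (∈-++⁻ (vars A) q∈)
∈-vars⇒Vars (A ⇒ B) q∈ = [ inj₁ ∘ ∈-vars⇒Vars A , inj₂ ∘ ∈-vars⇒Vars B ]′ (∈-++⁻ (vars A) q∈)
∈-vars⇒Vars (□ A)   q∈ = ∈-vars⇒Vars A q∈

boxes-trans : ∀ (A : Formula V) {C} → C ∈ boxes A → boxes C ⊆ boxes A
boxes-trans-++ : ∀ (A B : Formula V) {C} → C ∈ boxes A ++ boxes B → boxes C ⊆ boxes A ++ boxes B
boxes-trans (A ∧ B) C∈          = boxes-trans-++ A B C∈
boxes-trans (A ∨ B) C∈          = boxes-trans-++ A B C∈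
boxes-trans (A ⇒ B) (here refl) = id
boxes-trans (A ⇒ B) (there C∈)  = there ∘ boxes-trans-++ A B C∈
boxes-trans (□ A)   (here refl) = there
boxes-trans (□ A)   (there C∈)  = there ∘ boxes-trans A C∈
boxes-trans-++ A B C∈ =
  [ (λ C∈A → ∈-++⁺ˡ ∘ boxes-trans A C∈A) , (λ C∈B → ∈-++⁺ʳ (boxes A) ∘ boxes-trans B C∈B) ]′
    (∈-++⁻ (boxes A) C∈)

vars-boxes : ∀ (A : Formula V) {C} → C ∈ boxes A → vars C ⊆ vars A
vars-boxes-++ : ∀ (A B : Formula V) {C} → C ∈ boxes A ++ boxes B → vars C ⊆ vars A ++ vars B
vars-boxes (A ∧ B) C∈          = vars-boxes-++ A B C∈
vars-boxes (A ∨ B) C∈          = vars-boxes-++ A B C∈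
vars-boxes (A ⇒ B) (here refl) = id
vars-boxes (A ⇒ B) (there C∈)  = vars-boxes-++ A B C∈
vars-boxes (□ A)   (here refl) = id
vars-boxes (□ A)   (there C∈)  = vars-boxes A C∈
vars-boxes-++ A B C∈ =
  [ (λ C∈A → ∈-++⁺ˡ ∘ vars-boxes A C∈A) , (λ C∈B → ∈-++⁺ʳ (vars A) ∘ vars-boxes B C∈B) ]′
    (∈-++⁻ (boxes A) C∈)

-- Truth at a node, given the true variables ν and the formulas β forced by all children.
sem : (V → Set) → (Formula V → Set) → Formula V → Set
sem ν β (var q) = ν q
sem ν β ⊥ᶠ      = ⊥
sem ν β (A ∧ B) = sem ν β A × sem ν β B
sem ν β (A ∨ B) = sem ν β A ⊎ sem ν β B
sem ν β (A ⇒ B) = (sem ν β A → sem ν β B) × β (A ⇒ B)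
sem ν β (□ A)   = β A

sem? : {ν : V → Set} {β : Formula V → Set} → Unary.Decidable ν → Unary.Decidable β →
  Unary.Decidable (sem ν β)
sem? ν? β? (var q) = ν? q
sem? ν? β? ⊥ᶠ      = no id
sem? ν? β? (A ∧ B) = sem? ν? β? A ×-dec sem? ν? β? B
sem? ν? β? (A ∨ B) = sem? ν? β? A ⊎-dec sem? ν? β? B
sem? ν? β? (A ⇒ B) = (sem? ν? β? A →-dec sem? ν? β? B) ×-dec β? (A ⇒ B)
sem? ν? β? (□ A)   = β? A

-- Used to compare a node with its state, and a node with its variant at `p`, through only the data
-- that `A` can see.
sem-cong : {ν ν′ : V → Set} {β β′ : Formula V → Set} (A : Formula V) →
  (∀ {q} → q ∈ vars A → ν q ⇔ ν′ q) → (∀ {C} → C ∈ boxes A → β C ⇔ β′ C) →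
  sem ν β A ⇔ sem ν′ β′ A
sem-cong (var q) f g = f (here refl)
sem-cong ⊥ᶠ      f g = ⇔-id _
sem-cong (A ∧ B) f g =
  sem-cong A (f ∘ ∈-++⁺ˡ) (g ∘ ∈-++⁺ˡ) ×-⇔ sem-cong B (f ∘ ∈-++⁺ʳ (vars A)) (g ∘ ∈-++⁺ʳ (boxes A))
sem-cong (A ∨ B) f g =
  sem-cong A (f ∘ ∈-++⁺ˡ) (g ∘ ∈-++⁺ˡ) ⊎-⇔ sem-cong B (f ∘ ∈-++⁺ʳ (vars A)) (g ∘ ∈-++⁺ʳ (boxes A))
sem-cong (A ⇒ B) f g =
  →-cong-⇔ (sem-cong A (f ∘ ∈-++⁺ˡ) (g ∘ there ∘ ∈-++⁺ˡ))
           (sem-cong B (f ∘ ∈-++⁺ʳ (vars A)) (g ∘ there ∘ ∈-++⁺ʳ (boxes A)))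
  ×-⇔ g (here refl)
sem-cong (□ A)   f g = g (here refl)

-- Finite trees, forcing and persistence.

data Tree (V : Set) : Set where
  node : (V → Bool) → (n : ℕ) → (Fin n → Tree V) → Tree V

infix 4 _⊩_ _⊩?_ _⊑_

_⊩_ : Tree V → Formula V → Set
node v n f ⊩ A = sem (T ∘ v) (λ C → ∀ i → f i ⊩ C) A

_⊩?_ : (M : Tree V) (A : Formula V) → Dec (M ⊩ A)
node v n f ⊩? A = sem? (λ q → T? (v q)) (λ C → all? λ i → f i ⊩? C) A

∧-forced : ∀ (M : Tree V) {A B} → M ⊩ A → M ⊩ B → M ⊩ A ∧ B
∧-forced (node _ _ _) = _,_

∨-forced : ∀ (M : Tree V) {A B} → M ⊩ A ⊎ M ⊩ B → M ⊩ A ∨ B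
∨-forced (node _ _ _) = id

Persistent : Tree V → Set
Persistent (node v n f) = ∀ i → (∀ q → T (v q) → f i ⊩ var q) × Persistent (f i)

mono : ∀ {v : V → Bool} {n f} A → Persistent (node v n f) → node v n f ⊩ A → ∀ i → f i ⊩ A
mono (var q) pers h i = proj₁ (pers i) q h
mono {f = f} (A ∧ B) pers (a , b) i = ∧-forced (f i) (mono A pers a i) (mono B pers b i)
mono {f = f} (A ∨ B) pers (inj₁ a) i = ∨-forced (f i) (inj₁ (mono A pers a i))
mono {f = f} (A ∨ B) pers (inj₂ b) i = ∨-forced (f i) (inj₂ (mono B pers b i))
mono (A ⇒ B) pers (_ , h) i = h i
-- Child `i` forces `A`, so by monotonicity its own children do too, which is `□ A` at child `i`.
mono {f = f} (□ A) pers h i with f i | h i | proj₂ (pers i)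
... | node _ _ _ | a | pers′ = mono A pers′ a

data _⊑_ {V : Set} : Tree V → Tree V → Set where
  ⊑-refl  : ∀ {M} → M ⊑ M
  ⊑-child : ∀ {v n f N} i → f i ⊑ N → node v n f ⊑ N

⊑-Persistent : {M N : Tree V} → M ⊑ N → Persistent M → Persistent N
⊑-Persistent ⊑-refl        pers = pers
⊑-Persistent (⊑-child i s) pers = ⊑-Persistent s (proj₂ (pers i))

⊑-mono : ∀ {M N : Tree V} A → M ⊑ N → Persistent M → M ⊩ A → N ⊩ A
⊑-mono A ⊑-refl        pers h = h
⊑-mono A (⊑-child i s) pers h = ⊑-mono A s (proj₂ (pers i)) (mono A pers h i)

⇒-forced : ∀ (M : Tree V) A B → (∀ {N} → M ⊑ N → N ⊩ A → N ⊩ B) → M ⊩ A ⇒ B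
⇒-forced (node v n f) A B h = h ⊑-refl , λ i → ⇒-forced (f i) A B (h ∘ ⊑-child i)

⇒-apply : ∀ (M : Tree V) {A B} → M ⊩ A ⇒ B → M ⊩ A → M ⊩ B
⇒-apply (node v n f) = proj₁

-- Since forcing is decidable, either the classical implication fails at the root or some child
-- refutes `A ⇒ B`, and the search descends.
⇒-refuted : ∀ (M : Tree V) A B → ¬ M ⊩ A ⇒ B → ∃[ N ] M ⊑ N × N ⊩ A × ¬ N ⊩ B
⇒-refuted M@(node v n f) A B ¬h with M ⊩? A | M ⊩? B
... | yes a | no ¬b = M , ⊑-refl , a , ¬b
... | yes a | yes b with ¬∀⟶∃¬ n _ (λ i → f i ⊩? A ⇒ B) (λ h → ¬h ((λ _ → b) , h))
...   | i , ¬hi = let N , s , a , ¬b = ⇒-refuted (f i) A B ¬hi in N , ⊑-child i s , a , ¬b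
⇒-refuted M@(node v n f) A B ¬h | no ¬a | _
  with ¬∀⟶∃¬ n _ (λ i → f i ⊩? A ⇒ B) (λ h → ¬h ((λ a → contradiction a ¬a) , h))
...   | i , ¬hi = let N , s , a , ¬b = ⇒-refuted (f i) A B ¬hi in N , ⊑-child i s , a , ¬b

-- Soundness.

axiom-sound : {A : Formula V} → Axiom A → ∀ M → Persistent M → M ⊩ A
axiom-sound (⇒-const A B) M pers = ⇒-forced M _ _ λ s a → ⇒-forced _ _ _ λ s′ _ →
  ⊑-mono A s′ (⊑-Persistent s pers) a
axiom-sound (⇒-dist A B C) M pers =
  ⇒-forced M _ _ λ s abc → ⇒-forced _ _ _ λ s′ ab → ⇒-forced _ _ _ λ {N} s″ a →
  let pers′ = ⊑-Persistent s pers ; pers″ = ⊑-Persistent s′ pers′ in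
  ⇒-apply N (⇒-apply N (⊑-mono (A ⇒ B ⇒ C) s″ pers″ (⊑-mono (A ⇒ B ⇒ C) s′ pers′ abc)) a)
            (⇒-apply N (⊑-mono (A ⇒ B) s″ pers″ ab) a)
axiom-sound (∧-elimˡ A B) M pers = ⇒-forced M _ _ λ { {node _ _ _} _ → proj₁ }
axiom-sound (∧-elimʳ A B) M pers = ⇒-forced M _ _ λ { {node _ _ _} _ → proj₂ }
axiom-sound (∧-intro A B) M pers = ⇒-forced M _ _ λ s a → ⇒-forced _ _ _ λ
  { {node _ _ _} s′ b → ⊑-mono A s′ (⊑-Persistent s pers) a , b }
axiom-sound (∨-introˡ A B) M pers = ⇒-forced M _ _ λ { {node _ _ _} _ → inj₁ }
axiom-sound (∨-introʳ A B) M pers = ⇒-forced M _ _ λ { {node _ _ _} _ → inj₂ }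
axiom-sound (∨-elim A B C) M pers =
  ⇒-forced M _ _ λ s ac → ⇒-forced _ _ _ λ s′ bc → ⇒-forced _ _ _ λ
  { {N@(node _ _ _)} s″ → let pers′ = ⊑-Persistent s pers ; pers″ = ⊑-Persistent s′ pers′ in
    [ ⇒-apply N (⊑-mono (A ⇒ C) s″ pers″ (⊑-mono (A ⇒ C) s′ pers′ ac))
    , ⇒-apply N (⊑-mono (B ⇒ C) s″ pers″ bc) ]′ }
axiom-sound (⊥-elim A) M pers = ⇒-forced M _ _ λ { {node _ _ _} _ () }
axiom-sound (K A B) M pers = ⇒-forced M _ _ λ {N} s ab → ⇒-forced N _ _ λ
  { {node _ _ f} s′ a i → ⇒-apply (f i) (⊑-mono (□ (A ⇒ B)) s′ (⊑-Persistent s pers) ab i) (a i) }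
axiom-sound (SL A) M pers = ⇒-forced M _ _ λ {N} s → löb N (⊑-Persistent s pers)
  where
  löb : ∀ N → Persistent N → N ⊩ □ A ⇒ A → N ⊩ A
  -- Induction on the tree: once all children force `A`, the root forces `□ A`, and its local
  -- implication gives `A`.
  löb (node _ _ f) pers (h , hs) = h λ i → löb (f i) (proj₂ (pers i)) (hs i)
axiom-sound (KM A B) M pers = ⇒-forced M _ _ λ {N} s a → excluded N (⊑-Persistent s pers) a
  where
  excluded : ∀ N → Persistent N → N ⊩ □ A → N ⊩ B ∨ (B ⇒ A)
  excluded N@(node _ _ f) pers a with N ⊩? B
  ... | yes b = inj₁ b
  -- `B` fails at `N` and `A` is forced at every proper descendant, so `B ⇒ A` holds.
  ... | no ¬b = inj₂ ((λ b → contradiction b ¬b) , λ i →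
    ⇒-forced (f i) B A λ s _ → ⊑-mono A s (proj₂ (pers i)) (a i))

soundness : {A : Formula V} → ⊢KM A → ∀ M → Persistent M → M ⊩ A
soundness (Ax a)   M pers = axiom-sound a M pers
soundness (El ())
soundness (MP d e) M pers = ⇒-apply M (soundness e M pers) (soundness d M pers)
soundness (Nec d) (node _ _ f) pers i = soundness d (f i) (proj₂ (pers i))

-- Derivations from local hypotheses.

infix 4 _▷_
infixl 5 _·_

-- Necessitation is confined to theorems, so hypotheses are local and the deduction theorem holds.
data _▷_ {V : Set} (Γ : List (Formula V)) : Formula V → Set where
  thm : ∀ {A} → ⊢KM A → Γ ▷ A
  hyp : ∀ {A} → A ∈ Γ → Γ ▷ A
  _·_ : ∀ {A B} → Γ ▷ A ⇒ B → Γ ▷ A → Γ ▷ B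

private variable
  Γ Δ : List (Formula V)

ax : Axiom A → Γ ▷ A
ax = thm ∘ Ax

close : [] ▷ A → ⊢KM A
close (thm d) = d
close (d · e) = MP (close e) (close d)

weaken : Γ ⊆ Δ → Γ ▷ A → Δ ▷ A
weaken s (thm d) = thm d
weaken s (hyp x) = hyp (s x)
weaken s (d · e) = weaken s d · weaken s e

deduce : A ∷ Γ ▷ B → Γ ▷ A ⇒ B
deduce (thm d)           = ax (⇒-const _ _) · thm d
-- The combinator proof S K K of `A ⇒ A`; `⊥ᶠ ⇒ ⊥ᶠ` is an arbitrary filler.
deduce (hyp (here refl)) = ax (⇒-dist _ _ _) · ax (⇒-const _ _) · ax (⇒-const _ (⊥ᶠ ⇒ ⊥ᶠ))
deduce (hyp (there x))   = ax (⇒-const _ _) · hyp x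
deduce (d · e)           = ax (⇒-dist _ _ _) · deduce d · deduce e

⇒-trans : Γ ▷ A ⇒ B → Γ ▷ B ⇒ C → Γ ▷ A ⇒ C
⇒-trans d e = ax (⇒-dist _ _ _) · (ax (⇒-const _ _) · e) · d

∨-cases : Γ ▷ A ∨ B → Γ ▷ A ⇒ C → Γ ▷ B ⇒ C → Γ ▷ C
∨-cases d e f = ax (∨-elim _ _ _) · e · f · d

□-lift : Γ ▷ A → (∀ {D} → D ∈ Γ → Δ ▷ □ D) → Δ ▷ □ A
□-lift (thm d) g = thm (Nec d)
□-lift (hyp x) g = g x
□-lift (d · e) g = ax (K _ _) · □-lift d g · □-lift e g

-- SL is applied to `A ∧ □ A`: from `□ (A ∧ □ A)`, K yields `□ A`, which joins the hypothesis `A`.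
⇒□ : Γ ▷ A ⇒ □ A
⇒□ = deduce (ax (∧-elimʳ _ _) · (ax (SL _) · deduce
  (ax (∧-intro _ _) · hyp (there (here refl)) ·
    (ax (K _ _) · thm (Nec (Ax (∧-elimˡ _ _))) · hyp (here refl)))))

-- Δ and E arise from Γ and D by a cut on each f x: either f x joins the hypotheses, or it becomes
-- a disjunct of the goal.
split : (f : X → Formula V) (xs : List X) (Γ : List (Formula V)) (D : Formula V) →
  (∀ {ys} → ys ∈ sublists xs → ∀ {Δ E} → Γ ⊆ Δ → Δ ▷ D ⇒ E →
    (∀ {x} → x ∈ ys → Δ ▷ f x) → (∀ {x} → x ∈ xs → x ∉ ys → Δ ▷ f x ⇒ E) → Δ ▷ E) →
  Γ ▷ D
split f []       Γ D h = h (here refl) id (deduce (hyp (here refl))) (λ ()) (λ ())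
split f (x ∷ xs) Γ D h = ∨-cases without (deduce (hyp (here refl))) (deduce with-x)
  where
  with-x : f x ∷ Γ ▷ D
  with-x = split f xs (f x ∷ Γ) D λ ys∈ s d t u →
    h (∈-++⁺ˡ (∈-map⁺ (x ∷_) ys∈)) (s ∘ there) d
      (λ { (here refl) → hyp (s (here refl)) ; (there y∈) → t y∈ })
      (λ { (here refl) x∉ → contradiction (here refl) x∉ ; (there y∈) y∉ → u y∈ (y∉ ∘ there) })
  without : Γ ▷ D ∨ f x
  without = split f xs Γ (D ∨ f x) λ ys∈ s d t u →
    h (∈-++⁺ʳ _ ys∈) s (⇒-trans (ax (∨-introˡ _ _)) d) t
      (λ { (here refl) _ → ⇒-trans (ax (∨-introʳ _ _)) d ; (there y∈) y∉ → u y∈ y∉ })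

-- Decidable equality of formulas.

module _ {V : Set} (_≟ᵛ_ : DecidableEquality V) where

  infix 4 _≟_

  _≟_ : DecidableEquality (Formula V)
  var p ≟ var q = map′ (cong var) (λ { refl → refl }) (p ≟ᵛ q)
  ⊥ᶠ ≟ ⊥ᶠ = yes refl
  A ∧ B ≟ C ∧ D = map′ (uncurry (cong₂ _∧_)) (λ { refl → refl , refl }) (A ≟ C ×-dec B ≟ D)
  A ∨ B ≟ C ∨ D = map′ (uncurry (cong₂ _∨_)) (λ { refl → refl , refl }) (A ≟ C ×-dec B ≟ D)
  (A ⇒ B) ≟ (C ⇒ D) = map′ (uncurry (cong₂ _⇒_)) (λ { refl → refl , refl }) (A ≟ C ×-dec B ≟ D)
  □ A ≟ □ C = map′ (cong □_) (λ { refl → refl }) (A ≟ C)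
  var _ ≟ ⊥ᶠ = no λ ()
  var _ ≟ (_ ∧ _) = no λ ()
  var _ ≟ (_ ∨ _) = no λ ()
  var _ ≟ (_ ⇒ _) = no λ ()
  var _ ≟ □ _ = no λ ()
  ⊥ᶠ ≟ var _ = no λ ()
  ⊥ᶠ ≟ (_ ∧ _) = no λ ()
  ⊥ᶠ ≟ (_ ∨ _) = no λ ()
  ⊥ᶠ ≟ (_ ⇒ _) = no λ ()
  ⊥ᶠ ≟ □ _ = no λ ()
  (_ ∧ _) ≟ var _ = no λ ()
  (_ ∧ _) ≟ ⊥ᶠ = no λ ()
  (_ ∧ _) ≟ (_ ∨ _) = no λ ()
  (_ ∧ _) ≟ (_ ⇒ _) = no λ ()
  (_ ∧ _) ≟ □ _ = no λ ()
  (_ ∨ _) ≟ var _ = no λ ()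
  (_ ∨ _) ≟ ⊥ᶠ = no λ ()
  (_ ∨ _) ≟ (_ ∧ _) = no λ ()
  (_ ∨ _) ≟ (_ ⇒ _) = no λ ()
  (_ ∨ _) ≟ □ _ = no λ ()
  (_ ⇒ _) ≟ var _ = no λ ()
  (_ ⇒ _) ≟ ⊥ᶠ = no λ ()
  (_ ⇒ _) ≟ (_ ∧ _) = no λ ()
  (_ ⇒ _) ≟ (_ ∨ _) = no λ ()
  (_ ⇒ _) ≟ □ _ = no λ ()
  □ _ ≟ var _ = no λ ()
  □ _ ≟ ⊥ᶠ = no λ ()
  □ _ ≟ (_ ∧ _) = no λ ()
  □ _ ≟ (_ ∨ _) = no λ ()
  □ _ ≟ (_ ⇒ _) = no λ ()

  open import Data.List.Membership.DecPropositional _≟_ using (_∈?_)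
  open import Data.List.Membership.DecPropositional _≟ᵛ_ using () renaming (_∈?_ to _∈ᵛ?_)

  -- States over a fixed formula.

  module States (φ : Formula V) where

    -- Variables are included so that a state can record that its true variables persist to the
    -- children.
    Cl : List (Formula V)
    Cl = φ ∷ map var (vars φ) ++ boxes φ

    boxes⊆Cl : C ∈ Cl → boxes C ⊆ Cl
    boxes⊆Cl (here refl) = there ∘ ∈-++⁺ʳ (map var (vars φ))
    boxes⊆Cl (there C∈) with ∈-++⁻ (map var (vars φ)) C∈
    ... | inj₂ C∈φ = there ∘ ∈-++⁺ʳ (map var (vars φ)) ∘ boxes-trans φ C∈φ
    ... | inj₁ C∈vars with ∈-map⁻ var C∈vars
    ...   | _ , _ , refl = λ ()

    vars⊆vars-φ : C ∈ Cl → vars C ⊆ vars φ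
    vars⊆vars-φ (here refl) = id
    vars⊆vars-φ (there C∈) with ∈-++⁻ (map var (vars φ)) C∈
    ... | inj₂ C∈φ = vars-boxes φ C∈φ
    ... | inj₁ C∈vars with ∈-map⁻ var C∈vars
    ...   | _ , q∈ , refl = λ { (here refl) → q∈ }

    var∈Cl : ∀ {q} → q ∈ vars φ → var q ∈ Cl
    var∈Cl = there ∘ ∈-++⁺ˡ ∘ ∈-map⁺ var

    -- A state describes a node of a tree: the true variables of φ, and the members of Cl that
    -- are forced by all children.
    State : Set
    State = List V × List (Formula V)

    Holds : State → Formula V → Set
    Holds (u , B) = sem (_∈ u) (_∈ B)

    holds? : ∀ t A → Dec (Holds t A)
    holds? (u , B) = sem? (_∈ᵛ? u) (_∈? B)

    -- What the state of a node forcing `B` in a persistent tree must satisfy; the first two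
    -- conjuncts are persistence to the children.
    Above : List (Formula V) → State → Set
    Above B t@(u , B′) = All (_∈ B′) B × All (λ q → var q ∈ B′) u × All (Holds t) B

    above? : ∀ B t → Dec (Above B t)
    above? B t@(u , B′) = All.all? (_∈? B′) B ×-dec All.all? (λ q → var q ∈? B′) u ×-dec All.all? (holds? t) B

    -- By SL, a failure of A may be assumed to occur where □ A is true; this puts A into B′, so that
    -- fewer formulas are missing from B′ than from B.
    Refutes : List (Formula V) → Formula V → State → Set
    Refutes B A t@(u , B′) = Above B t × A ∈ B′ × ¬ Holds t A

    refutes? : ∀ B A t → Dec (Refutes B A t)
    refutes? B A t@(u , B′) = above? B t ×-dec A ∈? B′ ×-dec ¬? (holds? t A)

    states : List State
    states = cartesianProduct (sublists (vars φ)) (sublists Cl)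

    states-⊆Cl : ∀ {t} → t ∈ states → proj₂ t ⊆ Cl
    states-⊆Cl t∈ = ∈-sublists⇒⊆ Cl (proj₂ (∈-cartesianProduct⁻ (sublists (vars φ)) (sublists Cl) t∈))

    above : List (Formula V) → List State
    above B = filter (above? B) states

    refuting : List (Formula V) → Formula V → List State
    refuting B A = filter (refutes? B A) states

    -- Its length is the induction measure; its members are the formulas that some child has to
    -- refute.
    missing : List (Formula V) → List (Formula V)
    missing B = filter (λ C → ¬? (C ∈? B)) Cl

    ∈-missing : ∀ {B} → C ∈ missing B → C ∈ Cl × C ∉ B
    ∈-missing {B = B} = ∈-filter⁻ (λ C → ¬? (C ∈? B)) {xs = Cl}

    missing-≤ : ∀ {B B′} → B ⊆ B′ → length (missing B′) ≤ length (missing B)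
    missing-≤ {B} {B′} s = length-filter-≤ (λ C → ¬? (C ∈? B′)) (λ C → ¬? (C ∈? B)) (_∘ s) Cl

    missing-< : ∀ {B B′} → B ⊆ B′ → C ∈ Cl → C ∉ B → C ∈ B′ → length (missing B′) < length (missing B)
    missing-< {B = B} {B′} B⊆B′ C∈ C∉B C∈B′ =
      length-filter-< (λ C → ¬? (C ∈? B′)) (λ C → ¬? (C ∈? B)) (_∘ B⊆B′) C∈ C∉B (λ C∉B′ → C∉B′ C∈B′)

    none-missing : ∀ {B} → length (missing B) ≤ 0 → C ∈ Cl → C ∈ B
    none-missing {C = C} {B} le C∈ = decidable-stable (C ∈? B) λ C∉B →
      empty (missing B) le (∈-filter⁺ (λ D → ¬? (D ∈? B)) C∈ C∉B)
      where
      empty : ∀ xs → length xs ≤ 0 → C ∉ xs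
      empty [] _ ()

    -- The second and third hypotheses make `B` agree on `Cl` with the formulas forced by all
    -- children, so `sem-cong` applies. It serves both the countermodels for completeness and the
    -- variants at `p`.
    truth-lemma : ∀ {v n u B} {f : Fin n → Tree V} →
      (∀ {q} → q ∈ vars φ → T (v q) ⇔ q ∈ u) →
      (∀ i {C} → C ∈ B → f i ⊩ C) →
      (∀ {C} → C ∈ Cl → C ∉ B → ∃[ i ] ¬ f i ⊩ C) →
      ∀ {A} → A ∈ Cl → node v n f ⊩ A ⇔ Holds (u , B) A
    truth-lemma {B = B} v⇔u B-forced rest-refuted {A} A∈ = sem-cong A (v⇔u ∘ vars⊆vars-φ A∈) λ {C} C∈ →
      mk⇔ (λ h → decidable-stable (C ∈? B) λ C∉B →
            let i , ¬h = rest-refuted (boxes⊆Cl A∈ C∈) C∉B in ¬h (h i))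
          (λ C∈B i → B-forced i C∈B)

    -- Completeness: deriving what a state decides.

    module Valuation {t : State} {Γ D}
      (true-var  : ∀ {q} → q ∈ proj₁ t → Γ ▷ var q)
      (false-var : ∀ {q} → q ∈ vars φ → q ∉ proj₁ t → Γ ▷ var q ⇒ D)
      (true-box  : ∀ {C} → C ∈ proj₂ t → Γ ▷ □ C)
      (false-box : ∀ {C} → C ∈ Cl → C ∉ proj₂ t → Γ ▷ □ C ⇒ D)
      where

      -- A form of Kalmár's lemma in which the goal `D` stands in for falsity, so that case
      -- distinctions stay intuitionistic.
      holds  : ∀ A → vars A ⊆ vars φ → boxes A ⊆ Cl → Holds t A → Γ ▷ A ∨ D
      fails  : ∀ A → vars A ⊆ vars φ → boxes A ⊆ Cl → ¬ Holds t A → Γ ▷ A ⇒ D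

      holds (var q) vs bs q∈ = ax (∨-introˡ _ _) · true-var q∈
      holds (A ∧ B) vs bs (a , b) =
        ∨-cases (holds A (vs ∘ ∈-++⁺ˡ) (bs ∘ ∈-++⁺ˡ) a)
          (deduce (∨-cases (weaken there (holds B (vs ∘ ∈-++⁺ʳ (vars A)) (bs ∘ ∈-++⁺ʳ (boxes A)) b))
            (⇒-trans (ax (∧-intro _ _) · hyp (here refl)) (ax (∨-introˡ _ _)))
            (ax (∨-introʳ _ _))))
          (ax (∨-introʳ _ _))
      holds (A ∨ B) vs bs (inj₁ a) =
        ∨-cases (holds A (vs ∘ ∈-++⁺ˡ) (bs ∘ ∈-++⁺ˡ) a)
          (⇒-trans (ax (∨-introˡ _ _)) (ax (∨-introˡ _ _))) (ax (∨-introʳ _ _))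
      holds (A ∨ B) vs bs (inj₂ b) =
        ∨-cases (holds B (vs ∘ ∈-++⁺ʳ (vars A)) (bs ∘ ∈-++⁺ʳ (boxes A)) b)
          (⇒-trans (ax (∨-introʳ _ _)) (ax (∨-introˡ _ _))) (ax (∨-introʳ _ _))
      holds (A ⇒ B) vs bs (ab , box) with holds? t A
      ... | yes a = ∨-cases (holds B (vs ∘ ∈-++⁺ʳ (vars A)) (bs ∘ there ∘ ∈-++⁺ʳ (boxes A)) (ab a))
        (⇒-trans (ax (⇒-const _ _)) (ax (∨-introˡ _ _))) (ax (∨-introʳ _ _))
      -- KM splits into `A`, which yields `D` by `fails`, and `A ⇒ (A ⇒ B)`, which contracts to
      -- `A ⇒ B`.
      ... | no ¬a = ∨-cases (ax (KM (A ⇒ B) A) · true-box box)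
        (⇒-trans (fails A (vs ∘ ∈-++⁺ˡ) (bs ∘ there ∘ ∈-++⁺ˡ) ¬a) (ax (∨-introʳ _ _)))
        (⇒-trans (deduce (deduce (hyp (there (here refl)) · hyp (here refl) · hyp (here refl))))
          (ax (∨-introˡ _ _)))
      holds (□ A) vs bs box = ax (∨-introˡ _ _) · true-box box

      fails (var q) vs bs q∉ = false-var (vs (here refl)) q∉
      fails ⊥ᶠ vs bs _ = ax (⊥-elim _)
      fails (A ∧ B) vs bs ¬ab with holds? t A
      ... | no ¬a = ⇒-trans (ax (∧-elimˡ _ _)) (fails A (vs ∘ ∈-++⁺ˡ) (bs ∘ ∈-++⁺ˡ) ¬a)
      ... | yes a = ⇒-trans (ax (∧-elimʳ _ _))
        (fails B (vs ∘ ∈-++⁺ʳ (vars A)) (bs ∘ ∈-++⁺ʳ (boxes A)) (¬ab ∘ (a ,_)))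
      fails (A ∨ B) vs bs ¬ab = ax (∨-elim _ _ _)
        · fails A (vs ∘ ∈-++⁺ˡ) (bs ∘ ∈-++⁺ˡ) (¬ab ∘ inj₁)
        · fails B (vs ∘ ∈-++⁺ʳ (vars A)) (bs ∘ ∈-++⁺ʳ (boxes A)) (¬ab ∘ inj₂)
      fails (A ⇒ B) vs bs ¬ab with (A ⇒ B) ∈? proj₂ t | holds? t A | holds? t B
      -- Here `A ⇒ B` yields `□ (A ⇒ B)`, a box that the state makes false.
      ... | no ¬box | _     | _     = ⇒-trans ⇒□ (false-box (bs (here refl)) ¬box)
      ... | yes box | no ¬a | _     = contradiction ((λ a → contradiction a ¬a) , box) ¬ab
      ... | yes box | yes _ | yes b = contradiction ((λ _ → b) , box) ¬ab
      ... | yes box | yes a | no ¬b = deduce (∨-cases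
        (weaken there (holds A (vs ∘ ∈-++⁺ˡ) (bs ∘ there ∘ ∈-++⁺ˡ) a))
        (⇒-trans (hyp (here refl))
          (weaken there (fails B (vs ∘ ∈-++⁺ʳ (vars A)) (bs ∘ there ∘ ∈-++⁺ʳ (boxes A)) ¬b)))
        (deduce (hyp (here refl))))
      fails (□ A) vs bs ¬box = false-box (bs (here refl)) ¬box

    -- Completeness: proof or countermodel.

    Countermodel : List (Formula V) → Formula V → Set
    Countermodel B A = ∃[ M ] Persistent M × (∀ {C} → C ∈ B → M ⊩ C) × ¬ M ⊩ A

    -- A root with the variables of `t` gets one child per missing formula, refuting it and forcing
    -- `proj₂ t`. The root then has state `t`, and `truth-lemma` transfers the refutation.
    assemble : ∀ {B A t} → B ⊆ Cl → A ∈ Cl → t ∈ refuting B A →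
      (∀ {C} → C ∈ missing (proj₂ t) → Countermodel (proj₂ t) C) → Countermodel B A
    assemble {B} {A} {u , B′} B⊆Cl A∈ t∈ models with ∈-filter⁻ (refutes? B A) {xs = states} t∈
    ... | t∈states , ((B⊆B′ , u⊆B′ , B-holds) , A∈B′ , ¬A-holds) =
      M , (λ i → (λ q q∈ → forced i (All.lookup u⊆B′ (toWitness q∈))) , proj₁ (proj₂ (child i))) ,
      (λ C∈ → from (truth (B⊆Cl C∈)) (All.lookup B-holds C∈)) , ¬A-holds ∘ to (truth A∈)
      where
      child : (i : Fin (length (missing B′))) → Countermodel B′ (lookup (missing B′) i)
      child i = models (∈-lookup i)

      M : Tree V
      M = node (λ q → ⌊ q ∈ᵛ? u ⌋) (length (missing B′)) (proj₁ ∘ child)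

      forced : ∀ i {C} → C ∈ B′ → proj₁ (child i) ⊩ C
      forced i = proj₁ (proj₂ (proj₂ (child i)))

      truth : ∀ {C} → C ∈ Cl → M ⊩ C ⇔ Holds (u , B′) C
      truth = truth-lemma {f = proj₁ ∘ child} (λ _ → mk⇔ toWitness fromWitness) forced λ C∈ C∉ →
        let C∈′ = ∈-filter⁺ (λ D → ¬? (D ∈? B′)) C∈ C∉ ; i = Any.index C∈′ in
        i , subst (λ D → ¬ proj₁ (child i) ⊩ D) (sym (Any.lookup-index C∈′)) (proj₂ (proj₂ (proj₂ (child i))))

    -- SL supplies the extra hypothesis `□ A`, and `split` runs through all candidate states. A
    -- state outside `refuting B A` gives the goal directly; for the others `steps` provides a
    -- derivable missing formula.
    derive : ∀ {B A} → B ⊆ Cl → A ∈ Cl →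
      (∀ {t} → t ∈ refuting B A → ∃[ C ] C ∈ missing (proj₂ t) × proj₂ t ▷ C) → B ▷ A
    derive {B} {A} B⊆Cl A∈ steps = ax (SL A) · deduce
      (split var (vars φ) (□ A ∷ B) A λ u∈ {Δ} {E} s d tv fv →
        split □_ Cl Δ E λ B′∈ s′ d′ tb fb →
          decide u∈ B′∈ (s′ ∘ s) (⇒-trans (weaken s′ d) d′)
            (weaken s′ ∘ tv) (λ q∈ q∉ → ⇒-trans (weaken s′ (fv q∈ q∉)) d′) tb fb)
      where
      decide : ∀ {u B′ Δ E} → u ∈ sublists (vars φ) → B′ ∈ sublists Cl →
        □ A ∷ B ⊆ Δ → Δ ▷ A ⇒ E →
        (∀ {q} → q ∈ u → Δ ▷ var q) → (∀ {q} → q ∈ vars φ → q ∉ u → Δ ▷ var q ⇒ E) →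
        (∀ {C} → C ∈ B′ → Δ ▷ □ C) → (∀ {C} → C ∈ Cl → C ∉ B′ → Δ ▷ □ C ⇒ E) → Δ ▷ E
      decide {u} {B′} {Δ} {E} u∈ B′∈ sub A⇒E tv fv tb fb
        with All.all? (_∈? B′) B | All.all? (λ q → var q ∈? B′) u
           | All.all? (holds? (u , B′)) B | A ∈? B′ | holds? (u , B′) A
      ... | no ¬p | _ | _ | _ | _ =
        let C , C∈ , C∉ = find (All.¬All⇒Any¬ (_∈? B′) B ¬p) in
        fb (B⊆Cl C∈) C∉ · (⇒□ · hyp (sub (there C∈)))
      ... | _ | no ¬p | _ | _ | _ =
        let q , q∈ , q∉ = find (All.¬All⇒Any¬ (λ q → var q ∈? B′) u ¬p) in
        fb (var∈Cl (∈-sublists⇒⊆ (vars φ) u∈ q∈)) q∉ · (⇒□ · tv q∈)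
      ... | _ | _ | no ¬p | _ | _ =
        let C , C∈ , ¬h = find (All.¬All⇒Any¬ (holds? (u , B′)) B ¬p) in
        Valuation.fails tv fv tb fb C (vars⊆vars-φ (B⊆Cl C∈)) (boxes⊆Cl (B⊆Cl C∈)) ¬h · hyp (sub (there C∈))
      ... | _ | _ | _ | no A∉ | _ = fb A∈ A∉ · hyp (sub (here refl))
      ... | _ | _ | _ | _ | yes h =
        ∨-cases (Valuation.holds tv fv tb fb A (vars⊆vars-φ A∈) (boxes⊆Cl A∈) h)
          A⇒E (deduce (hyp (here refl)))
      ... | yes p₁ | yes p₂ | yes p₃ | yes A∈B′ | no ¬h =
        -- The derivation of `C` from `B′` lifts to `□ C` from the boxed members of `B′`, whereas
        -- this state counts `□ C` as false.
        let C , C∈′ , d = steps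
              (∈-filter⁺ (refutes? B A) (∈-cartesianProduct⁺ u∈ B′∈) ((p₁ , p₂ , p₃) , A∈B′ , ¬h))
            C∈ , C∉ = ∈-missing {B = B′} C∈′
        in fb C∈ C∉ · □-lift d tb

    -- A refuting state has `A` in its second component, so recursion on its missing formulas lowers
    -- the measure. Either one state has countermodels for all of them, or every state has a
    -- derivable one.
    search : ∀ n {B A} → B ⊆ Cl → A ∈ Cl → A ∉ B → length (missing B) ≤ n → B ▷ A ⊎ Countermodel B A
    search zero B⊆Cl A∈ A∉ le = contradiction (none-missing le A∈) A∉
    search (suc n) {B} {A} B⊆Cl A∈ A∉ le with some-or-all (refuting B A) explore
      where
      explore : ∀ {t} → t ∈ refuting B A →
        (∀ {C} → C ∈ missing (proj₂ t) → Countermodel (proj₂ t) C) ⊎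
        (∃[ C ] C ∈ missing (proj₂ t) × proj₂ t ▷ C)
      explore {u , B′} t∈ with ∈-filter⁻ (refutes? B A) {xs = states} t∈
      ... | t∈states , ((B⊆B′ , _) , A∈B′ , _) =
        swap (some-or-all (missing B′) λ C∈′ →
          let C∈ , C∉ = ∈-missing {B = B′} C∈′ in
          search n (states-⊆Cl t∈states) C∈ C∉ (≤-pred (≤-trans (missing-< (All.lookup B⊆B′) A∈ A∉ A∈B′) le)))
    ... | inj₁ (t , t∈ , models) = inj₂ (assemble B⊆Cl A∈ t∈ models)
    ... | inj₂ steps             = inj₁ (derive B⊆Cl A∈ steps)

  completeness : ∀ A → (∀ M → Persistent M → M ⊩ A) → ⊢KM A
  completeness A valid with States.search A _ {[]} (λ ()) (here refl) (λ ()) ≤-refl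
  ... | inj₁ d                  = close d
  ... | inj₂ (M , pers , _ , ¬h) = contradiction (valid M pers) ¬h

-- Finite conjunctions and disjunctions, and choice between conditions.

⊤ᶠ : Formula V
⊤ᶠ = ⊥ᶠ ⇒ ⊥ᶠ

⋀ ⋁ : List (Formula V) → Formula V
⋀ []       = ⊤ᶠ
⋀ (A ∷ As) = A ∧ ⋀ As
⋁ []       = ⊥ᶠ
⋁ (A ∷ As) = A ∨ ⋁ As

⊤-forced : ∀ (M : Tree V) → M ⊩ ⊤ᶠ
⊤-forced M = ⇒-forced M ⊥ᶠ ⊥ᶠ λ _ → id

⋀-forced : ∀ (M : Tree V) As → All (M ⊩_) As ⇔ M ⊩ ⋀ As
⋀-forced M []       = mk⇔ (λ _ → ⊤-forced M) (λ _ → [])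
⋀-forced M@(node _ _ _) (A ∷ As) = mk⇔
  (λ { (a ∷ as) → a , to (⋀-forced M As) as }) (λ (a , as) → a ∷ from (⋀-forced M As) as)

⋁-forced : ∀ (M : Tree V) As → Any (M ⊩_) As ⇔ M ⊩ ⋁ As
⋁-forced (node _ _ _) [] = mk⇔ (λ ()) (λ ())
⋁-forced M@(node _ _ _) (A ∷ As) = mk⇔
  (λ { (here a) → inj₁ a ; (there as) → inj₂ (to (⋁-forced M As) as) })
  [ here , there ∘ from (⋁-forced M As) ]′

-- A pair (A , B) stands for the non-persistent condition "A and not B".  The formula
-- choice C D ps says that at every later node forcing C, either D or one of the conditions holds.
choice : Formula V → Formula V → List (Formula V × Formula V) → Formula V
choice C D []             = C ⇒ D
choice C D ((A , B) ∷ ps) = choice (C ∧ B) D ps ∧ choice C (D ∨ A) ps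

Separates : Tree V → Formula V × Formula V → Set
Separates M (A , B) = M ⊩ A × ¬ M ⊩ B

-- At a single node, `C → D ∨ (A ∧ ¬ B)` amounts classically to `C ∧ B → D` together with
-- `C → D ∨ A`; the recursion removes one condition in this way.
choice-forced : ∀ (M : Tree V) {C D} ps →
  (∀ {N} → M ⊑ N → N ⊩ C → N ⊩ D ⊎ Any (Separates N) ps) → M ⊩ choice C D ps
choice-forced M {C} {D} [] h = ⇒-forced M C D λ s c → [ id , (λ ()) ]′ (h s c)
choice-forced M {C} {D} ((A , B) ∷ ps) h = ∧-forced M
  (choice-forced M ps λ { {N@(node _ _ _)} s (c , b) → case-with N b (h s c) })
  (choice-forced M ps λ {N} s c → case-without N (h s c))
  where
  case-with : ∀ N → N ⊩ B → N ⊩ D ⊎ Any (Separates N) ((A , B) ∷ ps) → N ⊩ D ⊎ Any (Separates N) ps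
  case-with N b (inj₁ d)                = inj₁ d
  case-with N b (inj₂ (here (_ , ¬b)))  = contradiction b ¬b
  case-with N b (inj₂ (there s))        = inj₂ s
  case-without : ∀ N → N ⊩ D ⊎ Any (Separates N) ((A , B) ∷ ps) → N ⊩ D ∨ A ⊎ Any (Separates N) ps
  case-without N (inj₁ d)              = inj₁ (∨-forced N (inj₁ d))
  case-without N (inj₂ (here (a , _))) = inj₁ (∨-forced N (inj₂ a))
  case-without N (inj₂ (there s))      = inj₂ s

choice-apply : ∀ (M : Tree V) {C D} ps → M ⊩ choice C D ps → M ⊩ C → M ⊩ D ⊎ Any (Separates M) ps
choice-apply M [] h c = inj₁ (⇒-apply M h c)
choice-apply M@(node _ _ _) ((A , B) ∷ ps) (h₁ , h₂) c with M ⊩? B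
... | yes b = map₂ there (choice-apply M ps h₁ (c , b))
... | no ¬b with choice-apply M ps h₂ c
...   | inj₁ (inj₁ d) = inj₁ d
...   | inj₁ (inj₂ a) = inj₂ (here (a , ¬b))
...   | inj₂ s        = inj₂ (there s)

unless : Dec X → Formula V → Formula V
unless (yes _) A = ⊤ᶠ
unless (no  _) A = A

-- Construction of the interpolants.

module _ {V : Set} (_≟ᵛ_ : DecidableEquality V) (φ : Formula V) (p : V) where

  open import Data.List.Membership.DecPropositional (_≟_ _≟ᵛ_) using (_∈?_)
  open import Data.List.Membership.DecPropositional _≟ᵛ_ using () renaming (_∈?_ to _∈ᵛ?_)
  open States _≟ᵛ_ φ

  kept : List V → List V
  kept = filter (λ q → ¬? (q ≟ᵛ p))

  kept⁺ : ∀ {q u} → q ∈ u → q ≢ p → q ∈ kept u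
  kept⁺ = ∈-filter⁺ (λ q → ¬? (q ≟ᵛ p))

  kept⁻ : ∀ {q u} → q ∈ kept u → q ∈ u × q ≢ p
  kept⁻ {u = u} = ∈-filter⁻ (λ q → ¬? (q ≟ᵛ p)) {xs = u}

  unforced : List V → List V
  unforced u = filter (λ q → ¬? (q ∈ᵛ? u)) (kept (vars φ))

  unforced⁻ : ∀ {q u} → q ∈ unforced u → q ∈ kept (vars φ) × q ∉ u
  unforced⁻ {u = u} = ∈-filter⁻ (λ q → ¬? (q ∈ᵛ? u)) {xs = kept (vars φ)}

  -- A state is realisable where `pre` is forced and `post` is not. Negative demands are collected
  -- in `post` because their negations are not persistent.
  pre : Formula V → State → Formula V
  pre A (u , _) = ⋀ (map var (kept u)) ∧ □ A

  post : (List (Formula V) → Formula V → Formula V) → State → Formula V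
  post F (u , B) = ⋁ (map var (unforced u) ++ map (λ C → □ F B C) (missing B))

  -- universal n B A is ∀p(⋀B ⇒ A) and existential n B is ∃p(⋀B), provided that at most n members
  -- of Cl are missing from B; pre and post describe the states realisable by a p-variant of a node.
  universal   : ℕ → List (Formula V) → Formula V → Formula V
  existential : ℕ → List (Formula V) → Formula V
  earlier     : ℕ → List (Formula V) → Formula V

  -- A harmless default: with nothing missing from `B`, no `A` in `Cl` lies outside `B`.
  universal zero    B A = ⊥ᶠ
  universal (suc n) B A =
    ⋀ (map (λ t → pre (existential n (proj₂ t)) t ⇒ post (universal n) t) (refuting B A))

  -- If B′ ⊆ B, the conjunct □ ∃p(⋀B′) would make the definition circular.  It can be replaced by ⊤:
  -- in a finite tree the guarded equation E ↔ F(□ E), with F monotone, has the solution F(⊤).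
  existential n B = choice ⊤ᶠ ⊥ᶠ
    (map (λ t → pre (unless (All.all? (_∈? B) (proj₂ t)) (earlier n (proj₂ t))) t , post (universal n) t)
         (above B))

  -- Also a default: at zero the outer list already contains `Cl`, so `unless` returns `⊤ᶠ`.
  earlier zero    B = ⊤ᶠ
  earlier (suc n) B = existential n B

  -- Every tree satisfies the conditions of its own state.

  stateOf : Tree V → State
  stateOf M = filter (λ q → M ⊩? var q) (vars φ) , filter (λ C → M ⊩? □ C) Cl

  stateOf∈states : ∀ M → stateOf M ∈ states
  stateOf∈states M = ∈-cartesianProduct⁺
    (filter∈sublists (λ q → M ⊩? var q) (vars φ)) (filter∈sublists (λ C → M ⊩? □ C) Cl)

  stateOf-truth : ∀ M {A} → A ∈ Cl → M ⊩ A ⇔ Holds (stateOf M) A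
  stateOf-truth M@(node _ _ _) {A} A∈ = sem-cong A
    (λ q∈ → mk⇔ (∈-filter⁺ (λ q → M ⊩? var q) (vars⊆vars-φ A∈ q∈))
                 (proj₂ ∘ ∈-filter⁻ (λ q → M ⊩? var q) {xs = vars φ}))
    (λ C∈ → mk⇔ (∈-filter⁺ (λ C → M ⊩? □ C) (boxes⊆Cl A∈ C∈))
                 (proj₂ ∘ ∈-filter⁻ (λ C → M ⊩? □ C) {xs = Cl}))

  stateOf-Above : ∀ M {B} → Persistent M → B ⊆ Cl → (∀ {C} → C ∈ B → M ⊩ C) → Above B (stateOf M)
  stateOf-Above M@(node _ _ _) pers B⊆Cl B-forced =
    All.tabulate (λ {C} C∈ → ∈-filter⁺ (λ C → M ⊩? □ C) (B⊆Cl C∈) (mono C pers (B-forced C∈))) ,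
    All.tabulate (λ {q} q∈ → let q∈φ , h = ∈-filter⁻ (λ q → M ⊩? var q) {xs = vars φ} q∈ in
      ∈-filter⁺ (λ C → M ⊩? □ C) (var∈Cl q∈φ) (mono (var q) pers h)) ,
    All.tabulate (λ C∈ → to (stateOf-truth M (B⊆Cl C∈)) (B-forced C∈))

  pre-stateOf : ∀ M {A} → M ⊩ □ A → M ⊩ pre A (stateOf M)
  pre-stateOf M@(node _ _ _) h = to (⋀-forced M _) (All.map⁺ (All.tabulate λ q∈ →
    proj₂ (∈-filter⁻ (λ q → M ⊩? var q) {xs = vars φ} (proj₁ (kept⁻ {u = proj₁ (stateOf M)} q∈))))) , h

  -- A forced disjunct would be a variable that the state should contain, or would make all children
  -- force a formula missing from the state.
  post-stateOf : ∀ {v n f} F → let M = node v n f ; B = proj₂ (stateOf M) in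
    (∀ i {C} → C ∈ missing B → f i ⊩ F B C → f i ⊩ C) → ¬ M ⊩ post F (stateOf M)
  post-stateOf {v} {n} {f} F sound h =
    [ false-vars , false-boxes ]′ (Any.++⁻ (map var (unforced u)) (from (⋁-forced M _) h))
    where
    M = node v n f
    u = proj₁ (stateOf M)
    B′ = proj₂ (stateOf M)

    false-vars : ¬ Any (M ⊩_) (map var (unforced u))
    false-vars a with find (Any.map⁻ a)
    ... | q , q∈ , hq =
      let q∈kept , q∉u = unforced⁻ {u = u} q∈ in
      q∉u (∈-filter⁺ (λ q → M ⊩? var q) (proj₁ (kept⁻ {u = vars φ} q∈kept)) hq)

    false-boxes : ¬ Any (M ⊩_) (map (λ C → □ F B′ C) (missing B′))
    false-boxes a with find (Any.map⁻ a)
    ... | C , C∈missing , hC with ∈-filter⁻ (λ C → ¬? (C ∈? B′)) {xs = Cl} C∈missing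
    ...   | C∈ , C∉B = C∉B (∈-filter⁺ (λ C → M ⊩? □ C) C∈ λ i → sound i C∈missing (hC i))

  boxes-stateOf : ∀ M {C} → C ∈ proj₂ (stateOf M) → C ∈ Cl × M ⊩ □ C
  boxes-stateOf M = ∈-filter⁻ (λ C → M ⊩? □ C) {xs = Cl}

  -- If `M` refuted `A`, its own state would index a conjunct of `universal` whose `pre` is forced
  -- and whose `post` is not.
  universal-elim : ∀ n {B A} M → B ⊆ Cl → A ∈ Cl → A ∉ B → length (missing B) ≤ n → Persistent M →
    M ⊩ universal n B A → (∀ {C} → C ∈ B → M ⊩ C) → M ⊩ A
  -- At each later node, that node's own state supplies the condition demanded by `choice`.
  existential-intro : ∀ n {B} M → B ⊆ Cl → length (missing B) ≤ n → Persistent M →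
    (∀ {C} → C ∈ B → M ⊩ C) → M ⊩ existential n B

  universal-elim zero    M B⊆Cl A∈ A∉ le pers h B-forced = contradiction (none-missing le A∈) A∉
  universal-elim (suc n) {B} {A} M@(node v k f) B⊆Cl A∈ A∉ le pers h B-forced =
    -- Induction on the tree makes the children force `A`; this puts `A` into `B′` and lowers the
    -- measure.
    step λ i → universal-elim (suc n) (f i) B⊆Cl A∈ A∉ le (proj₂ (pers i))
      (mono (universal (suc n) B A) pers h i) (λ {C} C∈ → mono C pers (B-forced C∈) i)
    where
    B′ : List (Formula V)
    B′ = proj₂ (stateOf M)

    M-above : Above B (stateOf M)
    M-above = stateOf-Above M pers B⊆Cl B-forced

    child-forced : ∀ i {C} → C ∈ B′ → f i ⊩ C
    child-forced i C∈ = proj₂ (boxes-stateOf M C∈) i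

    step : (∀ i → f i ⊩ A) → M ⊩ A
    step A-forced = decidable-stable (M ⊩? A) λ ¬a →
      let t∈ = ∈-filter⁺ (refutes? B A) (stateOf∈states M) (M-above , A∈B′ , ¬a ∘ from (stateOf-truth M A∈))
          pre⇒post = All.lookup (All.map⁻ (from (⋀-forced M _) h)) t∈
      in post-stateOf {f = f} (universal n)
           (λ i C∈missing hC → let C∈ , C∉ = ∈-missing C∈missing in
             universal-elim n (f i) (proj₁ ∘ boxes-stateOf M) C∈ C∉ le′ (proj₂ (pers i)) hC (child-forced i))
           (proj₁ pre⇒post (pre-stateOf M λ i →
             existential-intro n (f i) (proj₁ ∘ boxes-stateOf M) le′ (proj₂ (pers i)) (child-forced i)))
      where
      A∈B′ : A ∈ B′
      A∈B′ = ∈-filter⁺ (λ C → M ⊩? □ C) A∈ A-forced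

      le′ : length (missing B′) ≤ n
      le′ = ≤-pred (≤-trans (missing-< (All.lookup (proj₁ M-above)) A∈ A∉ A∈B′) le)

  existential-intro n {B} M B⊆Cl le pers B-forced = choice-forced M _ λ {N} s _ →
    inj₂ (Any.map⁺ (lose
      (∈-filter⁺ (above? B) (stateOf∈states N)
        (stateOf-Above N (⊑-Persistent s pers) B⊆Cl λ {C} C∈ → ⊑-mono C s pers (B-forced C∈)))
      (separates N (⊑-Persistent s pers) λ {C} C∈ → ⊑-mono C s pers (B-forced C∈))))
    where
    separates : ∀ N → Persistent N → (∀ {C} → C ∈ B → N ⊩ C) →
      let t = stateOf N in
      Separates N (pre (unless (All.all? (_∈? B) (proj₂ t)) (earlier n (proj₂ t))) t , post (universal n) t)
    separates N@(node v k f) pers B-forced =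
      pre-stateOf N (later (All.all? (_∈? B) B′)) ,
      post-stateOf {f = f} (universal n) (λ i C∈missing hC → let C∈ , C∉ = ∈-missing C∈missing in
        universal-elim n (f i) (proj₁ ∘ boxes-stateOf N) C∈ C∉ (≤-trans (missing-≤ B⊆B′) le)
          (proj₂ (pers i)) hC (λ C∈ → proj₂ (boxes-stateOf N C∈) i))
      where
      B′ = proj₂ (stateOf N)

      B⊆B′ : B ⊆ B′
      B⊆B′ = All.lookup (proj₁ (stateOf-Above N pers B⊆Cl B-forced))

      later : (d : Dec (All (_∈ B) B′)) → N ⊩ □ unless d (earlier n B′)
      later (yes _) i = ⊤-forced (f i)
      later (no ¬p) i with find (All.¬All⇒Any¬ (_∈? B) B′ ¬p)
      ... | C , C∈B′ , C∉B with boxes-stateOf N C∈B′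
      ...   | C∈ , _ = earlier-intro n (≤-trans (missing-< B⊆B′ C∈ C∉B C∈B′) le)
        where
        earlier-intro : ∀ n → length (missing B′) < n → f i ⊩ earlier n B′
        earlier-intro (suc m) le′ =
          existential-intro m (f i) (proj₁ ∘ boxes-stateOf N) (≤-pred le′) (proj₂ (pers i))
            (λ D∈ → proj₂ (boxes-stateOf N D∈) i)

  -- Realising states by trees that differ at `p`.

  infix 4 _≈_

  -- Stands in for bisimilarity up to `p`: children of a variant need not match those of the
  -- original one by one.
  _≈_ : Tree V → Tree V → Set
  M ≈ N = ∀ A → p ∉ vars A → M ⊩ A ⇔ N ⊩ A

  Realised : Tree V → List (Formula V) → Tree V → Set
  Realised M B N = Persistent N × N ≈ M × (∀ {C} → C ∈ B → N ⊩ C)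

  -- The later node `M′` is there because a refuted implication only fails at some later node.
  Refuted : Tree V → List (Formula V) → Formula V → Set
  Refuted M B A = ∃[ M′ ] M ⊑ M′ × ∃[ N ] Realised M′ B N × ¬ N ⊩ A

  revalue : List V → (V → Bool) → V → Bool
  revalue u v q with q ≟ᵛ p
  ... | yes _ = ⌊ q ∈ᵛ? u ⌋
  ... | no  _ = v q

  revalue-≢ : ∀ u v {q} → q ≢ p → T (revalue u v q) ⇔ T (v q)
  revalue-≢ u v {q} q≢p with q ≟ᵛ p
  ... | yes q≡p = contradiction q≡p q≢p
  ... | no  _   = ⇔-id _

  -- Away from `p`, `pre` forces the variables in `u` and the failure of `post` excludes the others;
  -- at `p` the valuation is read off `u`.
  revalue-state : ∀ {u B v n f F A q} → let M = node v n f in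
    M ⊩ pre A (u , B) → ¬ M ⊩ post F (u , B) → q ∈ vars φ → T (revalue u v q) ⇔ q ∈ u
  revalue-state {u} {B} {v} {n} {f} {F} {A} {q} h ¬h q∈ with q ≟ᵛ p
  ... | yes _   = mk⇔ toWitness fromWitness
  ... | no  q≢p = mk⇔
    (λ vq → decidable-stable (q ∈ᵛ? u) λ q∉ → ¬h (to (⋁-forced (node v n f) _)
      (Any.++⁺ˡ (Any.map⁺ (lose (∈-filter⁺ (λ q → ¬? (q ∈ᵛ? u)) (kept⁺ q∈ q≢p) q∉) vq)))))
    (λ q∈u → All.lookup (All.map⁻ (from (⋀-forced (node v n f) _) (proj₁ h))) (kept⁺ q∈u q≢p))

  module Realise {u B v k} {f : Fin k → Tree V} {F A}
    (pers : Persistent (node v k f))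
    (u⊆B : ∀ {q} → q ∈ u → var q ∈ B)
    (pre-forced : node v k f ⊩ pre A (u , B))
    (post-refuted : ¬ node v k f ⊩ post F (u , B))
    (children : ∀ i → ∃[ N ] Realised (f i) B N)
    (refuters : ∀ i {C} → C ∈ missing B → ¬ f i ⊩ F B C → Refuted (f i) B C)
    where

    l : ℕ
    l = length (missing B)

    -- The last component is one-sided, since a refuter agrees only with a node at or below some
    -- `f i`.
    Child : Tree V → Set
    Child N = Persistent N × (∀ {C} → C ∈ B → N ⊩ C) × (∀ C → p ∉ vars C → (∀ i → f i ⊩ C) → N ⊩ C)

    fromChild : ∀ i → Child (proj₁ (children i))
    fromChild i with children i
    ... | N , N-pers , N≈ , N-forced = N-pers , N-forced , λ C p∉ h → from (N≈ C p∉) (h i)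

    -- As `post` fails, so does its disjunct `□ F B C`, and some child `f i` refutes `F B C`.
    refuter : ∀ {C} → C ∈ missing B → ∃[ N ] Child N × ¬ N ⊩ C
    refuter {C} C∈
      with ¬∀⟶∃¬ k _ (λ i → f i ⊩? F B C) (λ h → post-refuted
        (to (⋁-forced (node v k f) _) (Any.++⁺ʳ (map var (unforced u))
          (Any.map⁺ {f = λ C → □ F B C} (lose C∈ h)))))
    ... | i , ¬FC with refuters i C∈ ¬FC
    ...   | M′ , s , N , (N-pers , N≈ , N-forced) , ¬C =
      N , (N-pers , N-forced , λ D p∉ h → from (N≈ D p∉) (⊑-mono {M = f i} D s (proj₂ (pers i)) (h i))) , ¬C

    pick : Fin k ⊎ Fin l → ∃[ N ] Child N
    pick (inj₁ i) = proj₁ (children i) , fromChild i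
    pick (inj₂ j) = let N , c , _ = refuter (∈-lookup j) in N , c

    g : Fin (k ℕ.+ l) → Tree V
    g x = proj₁ (pick (splitAt k x))

    g-child : ∀ x → Child (g x)
    g-child x = proj₂ (pick (splitAt k x))

    model : Tree V
    model = node (revalue u v) (k ℕ.+ l) g

    model-persistent : Persistent model
    model-persistent x = var-forced , proj₁ (g-child x)
      where
      var-forced : ∀ q → T (revalue u v q) → g x ⊩ var q
      var-forced q h with q ≟ᵛ p
      ... | yes _   = proj₁ (proj₂ (g-child x)) (u⊆B (toWitness h))
      ... | no  q≢p = proj₂ (proj₂ (g-child x)) (var q) (λ { (here refl) → q≢p refl })
        (mono {v = v} {f = f} (var q) pers h)

    -- For boxes, the first `k` children give one direction and the one-sided condition in `Child`
    -- the other.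
    model-≈ : model ≈ node v k f
    model-≈ D p∉ = sem-cong D
      (λ {q} q∈ → revalue-≢ u v λ { refl → p∉ q∈ })
      (λ {C} C∈ → mk⇔
        (λ h i → let N , _ , N≈ , _ = children i in
          to (N≈ C (p∉ ∘ vars-boxes D C∈))
            (subst (λ s → proj₁ (pick s) ⊩ C) (splitAt-↑ˡ k i l) (h (i ↑ˡ l))))
        (λ h x → proj₂ (proj₂ (g-child x)) C (p∉ ∘ vars-boxes D C∈) h))

    model-truth : ∀ {D} → D ∈ Cl → model ⊩ D ⇔ Holds (u , B) D
    model-truth = truth-lemma {f = g} (revalue-state {f = f} {F} {A} pre-forced post-refuted)
      (λ x → proj₁ (proj₂ (g-child x)))
      λ {C} C∈ C∉ → let C∈missing = ∈-filter⁺ (λ C → ¬? (C ∈? B)) C∈ C∉ ; j = Any.index C∈missing in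
        k ↑ʳ j , subst (λ s → ¬ proj₁ (pick s) ⊩ C) (sym (splitAt-↑ʳ k l j))
          (subst (λ D → ¬ proj₁ (refuter (∈-lookup j)) ⊩ D) (sym (Any.lookup-index C∈missing))
            (proj₂ (proj₂ (refuter (∈-lookup j)))))

  -- A failing conjunct yields a state and a later node with `pre` forced and `post` not; `Realise`
  -- builds a variant of that node in that state.
  universal-refuted : ∀ n {B A} M → B ⊆ Cl → A ∈ Cl → A ∉ B → length (missing B) ≤ n → Persistent M →
    ¬ M ⊩ universal n B A → Refuted M B A
  existential-realised : ∀ n {B} M → B ⊆ Cl → length (missing B) ≤ n → Persistent M →
    M ⊩ existential n B → ∃[ N ] Realised M B N

  universal-refuted zero M B⊆Cl A∈ A∉ le pers ¬h = contradiction (none-missing le A∈) A∉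
  universal-refuted (suc n) {B} {A} M B⊆Cl A∈ A∉ le pers ¬h
    with find (All.¬All⇒Any¬ (λ t → M ⊩? pre (existential n (proj₂ t)) t ⇒ post (universal n) t)
           (refuting B A) (¬h ∘ to (⋀-forced M _) ∘ All.map⁺))
  ... | t@(u , B′) , t∈ , ¬step
    with ⇒-refuted M (pre (existential n B′) t) (post (universal n) t) ¬step
       | ∈-filter⁻ (refutes? B A) {xs = states} t∈
  ...   | N@(node v k f) , s , pre-forced , post-refuted
        | t∈states , ((B⊆B′ , u⊆B′ , B-holds) , A∈B′ , ¬A-holds) =
    N , s , model ,
    (model-persistent , model-≈ , λ C∈ → from (model-truth (B⊆Cl C∈)) (All.lookup B-holds C∈)) ,
    ¬A-holds ∘ to (model-truth A∈)
    where
    N-pers = ⊑-Persistent s pers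

    le′ : length (missing B′) ≤ n
    le′ = ≤-pred (≤-trans (missing-< (All.lookup B⊆B′) A∈ A∉ A∈B′) le)

    children : ∀ i → ∃[ N′ ] Realised (f i) B′ N′
    children i =
      existential-realised n (f i) (states-⊆Cl t∈states) le′ (proj₂ (N-pers i)) (proj₂ pre-forced i)

    refuters : ∀ i {C} → C ∈ missing B′ → ¬ f i ⊩ universal n B′ C → Refuted (f i) B′ C
    refuters i C∈ = universal-refuted n (f i) (states-⊆Cl t∈states)
      (proj₁ (∈-missing {B = B′} C∈)) (proj₂ (∈-missing {B = B′} C∈)) le′ (proj₂ (N-pers i))

    open Realise {f = f} {universal n} {existential n B′}
      N-pers (All.lookup u⊆B′) pre-forced post-refuted children refuters

  existential-realised n {B} M@(node v k f) B⊆Cl le pers h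
    with choice-apply M (map _ (above B)) h (⊤-forced M)
  ... | inj₂ a with find (Any.map⁻ a)
  ...   | t@(u , B′) , t∈ , (pre-forced , post-refuted) with ∈-filter⁻ (above? B) {xs = states} t∈
  ...     | t∈states , (B⊆B′ , u⊆B′ , B-holds) =
    model , model-persistent , model-≈ , λ C∈ → from (model-truth (B⊆Cl C∈)) (All.lookup B-holds C∈)
    where
    children : ∀ i → ∃[ N ] Realised (f i) B′ N
    children i with All.all? (_∈? B) B′ | proj₂ pre-forced i
    -- Here `pre` carries `⊤ᶠ`; instead `existential n B` persists to the child, and the recursion
    -- is on the tree.
    ... | yes B′⊆B | _ =
      let N , N-pers , N≈ , N-forced = existential-realised n (f i) B⊆Cl le (proj₂ (pers i))
            (mono {v = v} {f = f} (existential n B) pers h i)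
      in N , N-pers , N≈ , N-forced ∘ All.lookup B′⊆B
    ... | no B′⊈B | hi with find (All.¬All⇒Any¬ (_∈? B) B′ B′⊈B)
    ...   | C , C∈B′ , C∉B =
      earlier-realised n (≤-trans (missing-< (All.lookup B⊆B′) (states-⊆Cl t∈states C∈B′) C∉B C∈B′) le) hi
      where
      earlier-realised : ∀ n → length (missing B′) < n → f i ⊩ earlier n B′ → ∃[ N ] Realised (f i) B′ N
      earlier-realised (suc m) le′ =
        existential-realised m (f i) (states-⊆Cl t∈states) (≤-pred le′) (proj₂ (pers i))

    refuters : ∀ i {C} → C ∈ missing B′ → ¬ f i ⊩ universal n B′ C → Refuted (f i) B′ C
    refuters i C∈ = universal-refuted n (f i) (states-⊆Cl t∈states)
      (proj₁ (∈-missing {B = B′} C∈)) (proj₂ (∈-missing {B = B′} C∈))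
      (≤-trans (missing-≤ (All.lookup B⊆B′)) le) (proj₂ (pers i))

    open Realise {f = f} {universal n} {unless (All.all? (_∈? B) B′) (earlier n B′)}
      pers (All.lookup u⊆B′) pre-forced post-refuted children refuters

  -- Variables of the interpolants.

  Allowed : Formula V → Set
  Allowed A = Vars A Unary.⊆ Vars φ Unary.∖ Unary.｛ p ｝

  kept-allowed : ∀ {q} → q ∈ kept (vars φ) → Allowed (var q)
  kept-allowed q∈ refl = let q∈φ , q≢p = kept⁻ {u = vars φ} q∈ in ∈-vars⇒Vars φ q∈φ , q≢p ∘ sym

  ⊤-allowed : Allowed ⊤ᶠ
  ⊤-allowed = [ (λ ()) , (λ ()) ]′

  ⋀-allowed : ∀ {As} → All Allowed As → Allowed (⋀ As)
  ⋀-allowed []       = ⊤-allowed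
  ⋀-allowed (a ∷ as) = [ a , ⋀-allowed as ]′

  ⋁-allowed : ∀ {As} → All Allowed As → Allowed (⋁ As)
  ⋁-allowed []       = λ ()
  ⋁-allowed (a ∷ as) = [ a , ⋁-allowed as ]′

  choice-allowed : ∀ {C D ps} → Allowed C → Allowed D →
    All (λ (A , B) → Allowed A × Allowed B) ps → Allowed (choice C D ps)
  choice-allowed c d []             = [ c , d ]′
  choice-allowed c d ((a , b) ∷ ps) = [ choice-allowed [ c , b ]′ d ps , choice-allowed c [ d , a ]′ ps ]′

  unless-allowed : ∀ A (d : Dec X) → Allowed A → Allowed (unless d A)
  unless-allowed A (yes _) a = ⊤-allowed
  unless-allowed A (no  _) a = a

  pre-allowed : ∀ A {t} → t ∈ states → Allowed A → Allowed (pre A t)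
  pre-allowed A {u , B} t∈ a = [ ⋀-allowed (All.map⁺ (All.tabulate λ q∈ →
    let q∈u , q≢p = kept⁻ {u = u} q∈ in
    kept-allowed (kept⁺
      (∈-sublists⇒⊆ (vars φ)
        (proj₁ (∈-cartesianProduct⁻ (sublists (vars φ)) (sublists Cl) t∈)) q∈u) q≢p))) , a ]′

  post-allowed : ∀ F t → (∀ B A → Allowed (F B A)) → Allowed (post F t)
  post-allowed F (u , B) a = ⋁-allowed (All.++⁺
    (All.map⁺ (All.tabulate λ q∈ → kept-allowed (proj₁ (unforced⁻ {u = u} q∈))))
    (All.map⁺ {f = λ C → □ F B C} (All.tabulate λ {C} _ → a B C)))

  universal-allowed   : ∀ n B A → Allowed (universal n B A)
  existential-allowed : ∀ n B → Allowed (existential n B)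
  earlier-allowed     : ∀ n B → Allowed (earlier n B)
  universal-allowed zero    B A = λ ()
  universal-allowed (suc n) B A = ⋀-allowed (All.map⁺ (All.tabulate λ {t} t∈ →
    [ pre-allowed (existential n (proj₂ t)) (proj₁ (∈-filter⁻ (refutes? B A) {xs = states} t∈))
        (existential-allowed n (proj₂ t))
    , post-allowed (universal n) t (universal-allowed n) ]′))
  existential-allowed n B = choice-allowed ⊤-allowed (λ ()) (All.map⁺ (All.tabulate λ {t} t∈ →
    pre-allowed (unless (All.all? (_∈? B) (proj₂ t)) (earlier n (proj₂ t)))
      (proj₁ (∈-filter⁻ (above? B) {xs = states} t∈))
      (unless-allowed (earlier n (proj₂ t)) (All.all? (_∈? B) (proj₂ t)) (earlier-allowed n (proj₂ t))) ,
    post-allowed (universal n) t (universal-allowed n)))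
  earlier-allowed zero    B = ⊤-allowed
  earlier-allowed (suc n) B = existential-allowed n B

  -- Uniform interpolation.

  ∀p ∃p : Formula V
  ∀p = universal (length (missing [])) [] φ
  ∃p = existential (length (missing (φ ∷ []))) (φ ∷ [])

  ∀p-allowed : Allowed ∀p
  ∀p-allowed = universal-allowed (length (missing [])) [] φ

  ∃p-allowed : Allowed ∃p
  ∃p-allowed = existential-allowed (length (missing (φ ∷ []))) (φ ∷ [])

  φ⊆Cl : φ ∷ [] ⊆ Cl
  φ⊆Cl (here refl) = here refl

  φ⇒∃p : ⊢KM φ ⇒ ∃p
  φ⇒∃p = completeness _≟ᵛ_ _ λ M pers → ⇒-forced M _ _ λ {N} s h →
    existential-intro _ N φ⊆Cl ≤-refl (⊑-Persistent s pers) λ { (here refl) → h }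

  ∀p⇒φ : ⊢KM ∀p ⇒ φ
  ∀p⇒φ = completeness _≟ᵛ_ _ λ M pers → ⇒-forced M _ _ λ {N} s h →
    universal-elim _ {[]} N (λ ()) (here refl) (λ ()) ≤-refl (⊑-Persistent s pers) h λ ()

  -- A node forcing `∃p` has a variant forcing `φ`, hence `ψ`, which transfers back because it is
  -- `p`-free.
  ∃p-least : ∀ ψ → p ∉ vars ψ → ⊢KM φ ⇒ ψ → ⊢KM ∃p ⇒ ψ
  ∃p-least ψ p∉ d = completeness _≟ᵛ_ _ λ M pers → ⇒-forced M _ _ λ {M′} s h →
    let N , N-pers , N≈ , φ-forced = existential-realised _ M′ φ⊆Cl ≤-refl (⊑-Persistent s pers) h
    in to (N≈ ψ p∉) (⇒-apply N (soundness d N N-pers) (φ-forced (here refl)))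

  -- By contraposition: were `∀p` not forced, some later node would have a variant refuting `φ`
  -- while still forcing `ψ`.
  ∀p-greatest : ∀ ψ → p ∉ vars ψ → ⊢KM ψ ⇒ φ → ⊢KM ψ ⇒ ∀p
  ∀p-greatest ψ p∉ d = completeness _≟ᵛ_ _ λ M pers → ⇒-forced M _ _ λ {M′} s h →
    decidable-stable (M′ ⊩? ∀p) λ ¬h →
      let M″ , s′ , N , (N-pers , N≈ , _) , ¬φ =
            universal-refuted _ {[]} M′ (λ ()) (here refl) (λ ()) ≤-refl (⊑-Persistent s pers) ¬h
      in ¬φ (⇒-apply N (soundness d N N-pers) (from (N≈ ψ p∉) (⊑-mono ψ s′ (⊑-Persistent s pers) h)))

theorem2 : (V : Set) → DecidableEquality V → V ↔ ℕ →
    (φ : Formula V) (p : V) →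
    ∃[ ∀pφ ] ∃[ ∃pφ ]
    (Vars ∃pφ Unary.⊆ Vars φ Unary.∖ Unary.｛ p ｝ × Vars ∀pφ Unary.⊆ Vars φ Unary.∖ Unary.｛ p ｝)
    × (⊢KM φ ⇒ ∃pφ × ⊢KM ∀pφ ⇒ φ)
    × ((ψ : Formula V) → p Unary.∉ Vars ψ →
    (⊢KM φ ⇒ ψ → ⊢KM ∃pφ ⇒ ψ) × (⊢KM ψ ⇒ φ → ⊢KM ψ ⇒ ∀pφ))
theorem2 V _≟ᵛ_ _ φ p =
  ∀p _≟ᵛ_ φ p , ∃p _≟ᵛ_ φ p ,
  (∃p-allowed _≟ᵛ_ φ p , ∀p-allowed _≟ᵛ_ φ p) ,
  (φ⇒∃p _≟ᵛ_ φ p , ∀p⇒φ _≟ᵛ_ φ p) ,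
  λ ψ p∉ → ∃p-least _≟ᵛ_ φ p ψ (p∉ ∘ ∈-vars⇒Vars ψ) , ∀p-greatest _≟ᵛ_ φ p ψ (p∉ ∘ ∈-vars⇒Vars ψ)
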